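{- Let $\mathbb{F}$ be a field, let $d=2$, and let $V$ be a vector space over $\mathbb{F}$ of dimension $d+1=3$. Let $\Phi = (A; \{E_i\}_{i=0}^2; A^*; \{E^*_i\}_{i=0}^2)$ be a Hessenberg system on $V$. Then $\Phi$ is TD.
   Context: $\mathrm{End}(V)$ is the algebra of $\mathbb{F}$-linear maps $V\to V$. An element of $\mathrm{End}(V)$ is multiplicity-free if it is diagonalizable and every eigenspace has dimension one. For multiplicity-free $A$ with eigenspaces ordered $V_0,\dots,V_d$, the corresponding primitive idempotents are $E_0,\dots,E_d \in \mathrm{End}(V)$, where $E_i$ acts as the identity on $V_i$ and as $0$ on $V_j$ for $j\neq i$. The superscript $*$ in $A^*$, $E_i^*$ is just notation (not an adjoint). A Hessenberg system on $V$ is a sequence $\Phi=(A; \{E_i\}_{i=0}^d; A^*; \{E^*_i\}_{i=0}^d)$ of elements of $\mathrm{End}(V)$ such that: (i) $A$ and $A^*$ are multiplicity-free; (ii) $\{E_i\}_{i=0}^d$ is an ordering of the primitive idempotents of $A$; (iii) $\{E^*_i\}_{i=0}^d$ is an ordering of the primitive idempotents of $A^*$; (iv) for $0\le i,j\le d$, $E_iA^*E_j=0$ if $i-j>1$ and $E_iA^*E_j\neq 0$ if $i-j=1$; (v) for $0\le i,j\le d$, $E^*_iAE^*_j=0$ if $i-j>1$ and $E^*_iAE^*_j\neq 0$ if $i-j=1$. A Hessenberg system $\Phi$ is TD if there exist scalars $\beta,\gamma,\gamma^*,\varrho,\varrho^*\in\mathbb{F}$ such that $$0=[A, A^2A^*-\beta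 AA^*A+A^*A^2-\gamma(AA^*+A^*A)-\varrho A^*],$$ $$0=[A^*, A^{*2}A-\beta A^*AA^*+AA^{*2}-\gamma^*(A^*A+AA^*)-\varrho^*A],$$ where $[X,Y]=XY-YX$. -}

module Defs where

open import Algebra.Apartness.Bundles using (HeytingField; HeytingCommutativeRing)
open import Algebra.Bundles using (CommutativeMonoid; CommutativeRing)
open import Algebra.Module.Bundles using (Module)
open import Algebra.Module.Morphism.Structures using (IsModuleHomomorphism)
import Algebra.Module.Morphism.Construct.Composition as Composition
open import Algebra.Definitions.RawMonoid using (sum)
import Algebra.Properties.CommutativeSemigroup as CommutativeSemigroupProperties
open import Data.Fin.Base using (Fin; toℕ)
open import Data.Nat.Base using (ℕ; suc; _<_)
open import Data.Product.Base using (Σ-syntax; ∃-syntax; _×_)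
open import Data.Vec.Functional using (Vector)
open import Function.Definitions using (Injective)
open import Level using (Level; _⊔_) renaming (suc to lsuc)
open import Relation.Binary.PropositionalEquality.Core using (_≡_; _≢_)
open import Relation.Nullary.Negation.Core using (¬_)
open import Relation.Unary using (Pred; U)

-- Fields are the library's Heyting fields.  Classically these are exactly the
-- fields: x # y holds iff x - y is invertible, tightness says that a
-- non-invertible element is zero, and irreflexivity of # excludes 0 ≈ 1.
VectorSpace : ∀ {c ℓ₁ ℓ₂} → HeytingField c ℓ₁ ℓ₂ → (m ℓm : Level) →
              Set (c ⊔ ℓ₁ ⊔ lsuc (m ⊔ ℓm))
VectorSpace F = Module commutativeRing
  where open HeytingCommutativeRing (HeytingField.heytingCommutativeRing F)
          using (commutativeRing)

module _ {c ℓ₁ ℓ₂ m ℓm : Level}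
         (F : HeytingField c ℓ₁ ℓ₂) (V : VectorSpace F m ℓm) where

  private
    module F = CommutativeRing
      (HeytingCommutativeRing.commutativeRing (HeytingField.heytingCommutativeRing F))
  open Module V

  linearCombination : ∀ {n} → Vector F.Carrier n → Vector Carrierᴹ n → Carrierᴹ
  linearCombination a b = sum +ᴹ-rawMonoid (λ i → a i *ₗ b i)

  record IsBasis {p} (P : Pred Carrierᴹ p) {n : ℕ} (b : Vector Carrierᴹ n) :
                 Set (c ⊔ ℓ₁ ⊔ m ⊔ ℓm ⊔ p) where
    field
      members     : ∀ i → P (b i)
      independent : ∀ a → linearCombination a b ≈ᴹ 0ᴹ → ∀ i → a i F.≈ F.0#
      spanning    : ∀ {v} → P v → ∃[ a ] v ≈ᴹ linearCombination a b

  SubspaceHasDimension : ∀ {p} → Pred Carrierᴹ p → ℕ → Set (c ⊔ ℓ₁ ⊔ m ⊔ ℓm ⊔ p)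
  SubspaceHasDimension P n = Σ[ b ∈ Vector Carrierᴹ n ] IsBasis P b

  HasDimension : ℕ → Set (c ⊔ ℓ₁ ⊔ m ⊔ ℓm)
  HasDimension = SubspaceHasDimension U

  record End : Set (c ⊔ m ⊔ ℓm) where
    constructor mkEnd
    field
      ⟦_⟧                  : Carrierᴹ → Carrierᴹ
      isModuleHomomorphism : IsModuleHomomorphism rawModule rawModule ⟦_⟧
    open IsModuleHomomorphism isModuleHomomorphism public

  open End using (⟦_⟧)

  -- Additivity and homogeneity for left scalars give the remaining fields of
  -- IsModuleHomomorphism.
  linear : (f : Carrierᴹ → Carrierᴹ) →
           (∀ {x y} → x ≈ᴹ y → f x ≈ᴹ f y) →
           (∀ x y → f (x +ᴹ y) ≈ᴹ f x +ᴹ f y) →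
           (∀ a x → f (a *ₗ x) ≈ᴹ a *ₗ f x) → End
  linear f f-cong f-+ f-* = mkEnd f record
    { isBimoduleHomomorphism = record
      { +ᴹ-isGroupHomomorphism = record
        { isMonoidHomomorphism = record
          { isMagmaHomomorphism = record
            { isRelHomomorphism = record { cong = f-cong }
            ; homo = f-+
            }
          ; ε-homo = f-0
          }
        ; ⁻¹-homo = λ x → uniqueʳ‿-ᴹ (f x) (f (-ᴹ x))
            (≈ᴹ-trans (≈ᴹ-sym (f-+ x (-ᴹ x)))
                      (≈ᴹ-trans (f-cong (-ᴹ‿inverseʳ x)) f-0))
        }
      ; *ₗ-homo = f-*
      ; *ᵣ-homo = λ a x →
          ≈ᴹ-trans (f-cong (≈ᴹ-sym (*ₗ-*ᵣ-coincident a x)))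
                   (≈ᴹ-trans (f-* a x) (*ₗ-*ᵣ-coincident a (f x)))
      }
    }
    where
    f-0 : f 0ᴹ ≈ᴹ 0ᴹ
    f-0 = ≈ᴹ-trans (f-cong (≈ᴹ-sym (*ₗ-zeroˡ 0ᴹ)))
                   (≈ᴹ-trans (f-* F.0# 0ᴹ) (*ₗ-zeroˡ (f 0ᴹ)))

  infix  4 _≈ᴱ_ _≉ᴱ_
  infixl 6 _+ᴱ_ _-ᴱ_
  infixr 7 _·_
  infixl 8 _∙_

  _≈ᴱ_ : End → End → Set (m ⊔ ℓm)
  X ≈ᴱ Y = ∀ v → ⟦ X ⟧ v ≈ᴹ ⟦ Y ⟧ v

  _≉ᴱ_ : End → End → Set (m ⊔ ℓm)
  X ≉ᴱ Y = ¬ (X ≈ᴱ Y)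

  0ᴱ : End
  0ᴱ = linear (λ _ → 0ᴹ) (λ _ → ≈ᴹ-refl)
              (λ _ _ → ≈ᴹ-sym (+ᴹ-identityˡ 0ᴹ)) (λ a _ → ≈ᴹ-sym (*ₗ-zeroʳ a))

  _∙_ : End → End → End
  X ∙ Y = mkEnd (λ v → ⟦ X ⟧ (⟦ Y ⟧ v))
    (Composition.isModuleHomomorphism ≈ᴹ-trans
      (End.isModuleHomomorphism Y) (End.isModuleHomomorphism X))

  _+ᴱ_ : End → End → End
  X +ᴱ Y = linear (λ v → ⟦ X ⟧ v +ᴹ ⟦ Y ⟧ v)
    (λ p → +ᴹ-cong (X.⟦⟧-cong p) (Y.⟦⟧-cong p))
    (λ x y → ≈ᴹ-trans (+ᴹ-cong (X.+ᴹ-homo x y) (Y.+ᴹ-homo x y)) (interchange _ _ _ _))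
    (λ a x → ≈ᴹ-trans (+ᴹ-cong (X.*ₗ-homo a x) (Y.*ₗ-homo a x))
                      (≈ᴹ-sym (*ₗ-distribˡ a _ _)))
    where
    module X = End X
    module Y = End Y
    open CommutativeSemigroupProperties
      (CommutativeMonoid.commutativeSemigroup +ᴹ-commutativeMonoid)
      using (interchange)

  _·_ : F.Carrier → End → End
  a · X = linear (λ v → a *ₗ ⟦ X ⟧ v)
    (λ p → *ₗ-cong F.refl (X.⟦⟧-cong p))
    (λ x y → ≈ᴹ-trans (*ₗ-cong F.refl (X.+ᴹ-homo x y)) (*ₗ-distribˡ a _ _))
    (λ b x → ≈ᴹ-trans (*ₗ-cong F.refl (X.*ₗ-homo b x)) (*ₗ-comm a b (⟦ X ⟧ x)))
    where module X = End X

  _-ᴱ_ : End → End → End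
  X -ᴱ Y = X +ᴱ (F.- F.1#) · Y

  [_,_] : End → End → End
  [ X , Y ] = X ∙ Y -ᴱ Y ∙ X

  Eigenspace : End → F.Carrier → Pred Carrierᴹ ℓm
  Eigenspace A θ v = ⟦ A ⟧ v ≈ᴹ θ *ₗ v

  IsEigenvalue : End → F.Carrier → Set (m ⊔ ℓm)
  IsEigenvalue A θ = ∃[ v ] v ≉ᴹ 0ᴹ × Eigenspace A θ v

  Diagonalizable : End → Set (c ⊔ ℓ₁ ⊔ m ⊔ ℓm)
  Diagonalizable A = ∃[ n ] Σ[ b ∈ Vector Carrierᴹ n ]
    IsBasis U b × (∀ i → ∃[ θ ] Eigenspace A θ (b i))

  MultiplicityFree : End → Set (c ⊔ ℓ₁ ⊔ m ⊔ ℓm)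
  MultiplicityFree A = Diagonalizable A ×
    (∀ θ → IsEigenvalue A θ → SubspaceHasDimension (Eigenspace A θ) 1)

  -- An ordering V₀, …, V_d of the eigenspaces is given by the corresponding
  -- ordering θ₀, …, θ_d of the eigenvalues, each listed exactly once.
  record IsPrimitiveIdempotents (A : End) {d : ℕ} (E : Fin (suc d) → End) :
                                Set (c ⊔ ℓ₁ ⊔ m ⊔ ℓm) where
    field
      θ            : Fin (suc d) → F.Carrier
      θ-eigenvalue : ∀ i → IsEigenvalue A (θ i)
      θ-distinct   : Injective _≡_ F._≈_ θ
      θ-exhaustive : ∀ t → IsEigenvalue A t → ∃[ i ] t F.≈ θ i
      acts-as-id   : ∀ i {v} → Eigenspace A (θ i) v → ⟦ E i ⟧ v ≈ᴹ v
      acts-as-0    : ∀ {i j} → j ≢ i → ∀ {v} → Eigenspace A (θ j) v → ⟦ E i ⟧ v ≈ᴹ 0ᴹ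

  record HessenbergSystem (d : ℕ) : Set (c ⊔ ℓ₁ ⊔ m ⊔ ℓm) where
    field
      A  : End
      E  : Fin (suc d) → End
      A* : End
      E* : Fin (suc d) → End

      A-multiplicityFree  : MultiplicityFree A
      A*-multiplicityFree : MultiplicityFree A*
      E-idempotents       : IsPrimitiveIdempotents A E
      E*-idempotents      : IsPrimitiveIdempotents A* E*

      -- i - j > 1 and i - j = 1, with the (integer) subtraction cleared.
      EA*E-zero    : ∀ i j → suc (toℕ j) < toℕ i → E i ∙ A* ∙ E j ≈ᴱ 0ᴱ
      EA*E-nonzero : ∀ i j → toℕ i ≡ suc (toℕ j) → E i ∙ A* ∙ E j ≉ᴱ 0ᴱ
      E*AE*-zero    : ∀ i j → suc (toℕ j) < toℕ i → E* i ∙ A ∙ E* j ≈ᴱ 0ᴱ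
      E*AE*-nonzero : ∀ i j → toℕ i ≡ suc (toℕ j) → E* i ∙ A ∙ E* j ≉ᴱ 0ᴱ

  IsTD : ∀ {d} → HessenbergSystem d → Set (c ⊔ m ⊔ ℓm)
  IsTD Φ = ∃[ β ] ∃[ γ ] ∃[ γ* ] ∃[ ϱ ] ∃[ ϱ* ]
      (0ᴱ ≈ᴱ [ A , A ∙ A ∙ A* -ᴱ β · A ∙ A* ∙ A +ᴱ A* ∙ A ∙ A
                   -ᴱ γ · (A ∙ A* +ᴱ A* ∙ A) -ᴱ ϱ · A* ])
    × (0ᴱ ≈ᴱ [ A* , A* ∙ A* ∙ A -ᴱ β · A* ∙ A ∙ A* +ᴱ A ∙ A* ∙ A*
                    -ᴱ γ* · (A* ∙ A +ᴱ A ∙ A*) -ᴱ ϱ* · A ])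
    where open HessenbergSystem Φ

{-# OPTIONS --safe #-}

-- A multiplicity-free A with three eigenvalues is a root of the monic cubic
-- t³ - γt² - ϱt - κ with these roots.  Taking β = -1 makes the first argument
-- telescope:
--   [A, A²A* + AA*A + A*A² - γ(AA* + A*A) - ϱA*] = [A³ - γA² - ϱA, A*],
-- and the right hand side is [κ, A*] = 0.  The same β serves A*.
module Submission where

open import Defs
open import Algebra.Apartness.Bundles using (HeytingField; HeytingCommutativeRing)
open import Algebra.Bundles using (CommutativeRing)
open import Algebra.Module.Bundles using (Module)
import Algebra.Apartness.Properties.HeytingCommutativeRing as HeytingCommutativeRingProperties
import Algebra.Module.Properties.LeftModule as LeftModuleProperties
import Algebra.Properties.CommutativeMonoid.Sum as Sum
import Algebra.Properties.Ring as RingProperties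
import Algebra.Solver.CommutativeMonoid as CommutativeMonoidSolver
import Algebra.Solver.Ring.NaturalCoefficients.Default as SemiringSolver
open import Data.Fin.Base using (Fin; zero; suc)
open import Data.Fin.Patterns using (0F; 1F; 2F)
open import Data.Nat.Base using (zero; suc)
open import Data.Product.Base using (_,_; proj₂; ∃-syntax)
open import Data.Unit.Base using (tt)
open import Data.Vec.Functional using (Vector; replicate; updateAt)
open import Function.Base using (const; _∘_)
open import Level using (Level)
import Relation.Binary.Reasoning.Setoid as SetoidReasoning
open import Relation.Nullary.Negation.Core using (¬_)

module _ {c ℓ₁ ℓ₂ m ℓm : Level}
         (F : HeytingField c ℓ₁ ℓ₂) (V : VectorSpace F m ℓm) where

  private
    module H = HeytingCommutativeRing (HeytingField.heytingCommutativeRing F)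
    module F where
      open CommutativeRing H.commutativeRing public
      open RingProperties ring public

  open F using (_+_; _*_; -_; 0#; 1#; _≈_)
  open Module V
  open LeftModuleProperties leftModule using (inverseˡ-uniqueᴹ)
  open Sum +ᴹ-commutativeMonoid using (sum-cong-≋; sum-replicate-zero)
  open CommutativeMonoidSolver +ᴹ-commutativeMonoid using (solve; _⊜_; _⊕_)
  open SetoidReasoning ≈ᴹ-setoid
  open End using (⟦_⟧)

  1≉0 : ¬ 1# ≈ 0#
  -- The second half of tightness says that equal elements are not apart, whereas `1#` and `0#` are
  -- apart.
  1≉0 1≈0 = proj₂ (HeytingField.tight F 1# 0#) 1≈0
    (HeytingCommutativeRingProperties.1#0 (HeytingField.heytingCommutativeRing F))

  linearCombination-indicator : ∀ {n} (b : Vector Carrierᴹ n) i →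
    linearCombination F V (updateAt (replicate n 0#) i (const 1#)) b ≈ᴹ b i
  linearCombination-indicator {suc n} b zero = begin
    1# *ₗ b zero +ᴹ linearCombination F V (replicate n 0#) (b ∘ suc)
      ≈⟨ +ᴹ-cong (*ₗ-identityˡ (b zero))
           (≈ᴹ-trans (sum-cong-≋ (*ₗ-zeroˡ ∘ b ∘ suc)) (sum-replicate-zero n)) ⟩
    b zero +ᴹ 0ᴹ ≈⟨ +ᴹ-identityʳ (b zero) ⟩
    b zero       ∎
  linearCombination-indicator b (suc i) = begin
    0# *ₗ b zero +ᴹ linearCombination F V _ (b ∘ suc)
      ≈⟨ +ᴹ-cong (*ₗ-zeroˡ (b zero)) (linearCombination-indicator (b ∘ suc) i) ⟩
    0ᴹ +ᴹ b (suc i) ≈⟨ +ᴹ-identityˡ (b (suc i)) ⟩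
    b (suc i)       ∎

  -- Independence is tested on the indicator coefficients of `i`: if `b i` were zero, their
  -- combination would vanish and force `1# ≈ 0#`. This makes the members of an eigenbasis genuine
  -- eigenvectors.
  basis-nonzero : ∀ {p} {P : Carrierᴹ → Set p} {n} {b : Vector Carrierᴹ n} →
                  IsBasis F V P b → ∀ i → ¬ b i ≈ᴹ 0ᴹ
  basis-nonzero {b = b} basis i bi≈0 = 1≉0 (F.trans (F.sym (updated i))
    (IsBasis.independent basis _ (≈ᴹ-trans (linearCombination-indicator b i) bi≈0) i))
    where
    updated : ∀ {n} (i : Fin n) → updateAt (replicate n 0#) i (const 1#) i ≈ 1#
    updated zero    = F.refl
    updated (suc i) = updated i

  vanishes-on-linearCombination : ∀ (X : End F V) {n} (b : Vector Carrierᴹ n) →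
    (∀ i → ⟦ X ⟧ (b i) ≈ᴹ 0ᴹ) → ∀ a → ⟦ X ⟧ (linearCombination F V a b) ≈ᴹ 0ᴹ
  vanishes-on-linearCombination X {zero}  b Xb≈0 a = End.0ᴹ-homo X
  vanishes-on-linearCombination X {suc n} b Xb≈0 a = begin
    ⟦ X ⟧ (a zero *ₗ b zero +ᴹ linearCombination F V (a ∘ suc) (b ∘ suc))
      ≈⟨ End.+ᴹ-homo X _ _ ⟩
    ⟦ X ⟧ (a zero *ₗ b zero) +ᴹ ⟦ X ⟧ (linearCombination F V (a ∘ suc) (b ∘ suc))
      ≈⟨ +ᴹ-cong
           (≈ᴹ-trans (End.*ₗ-homo X _ _)
             (≈ᴹ-trans (*ₗ-congˡ (Xb≈0 zero)) (*ₗ-zeroʳ (a zero))))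
           (vanishes-on-linearCombination X (b ∘ suc) (Xb≈0 ∘ suc) (a ∘ suc)) ⟩
    0ᴹ +ᴹ 0ᴹ ≈⟨ +ᴹ-identityˡ 0ᴹ ⟩
    0ᴹ       ∎

  idᴱ : End F V
  idᴱ = linear F V (λ v → v) (λ p → p) (λ _ _ → ≈ᴹ-refl) (λ _ _ → ≈ᴹ-refl)

  -- All signs are positive, so `p`, `q`, `r` stand for -γ, -ϱ, -κ.
  cubic : End F V → F.Carrier → F.Carrier → F.Carrier → End F V
  cubic A p q r =
    _+ᴱ_ F V (_+ᴱ_ F V (_+ᴱ_ F V (_∙_ F V (_∙_ F V A A) A)
      (_·_ F V p (_∙_ F V A A))) (_·_ F V q A)) (_·_ F V r idᴱ)

  cubic-eigenvector : ∀ (A : End F V) {t v} p q r → Eigenspace F V A t v →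
    ⟦ cubic A p q r ⟧ v ≈ᴹ (t * (t * t) + p * (t * t) + q * t + r) *ₗ v
  cubic-eigenvector A {t} {v} p q r Av≈tv = begin
    ⟦ cubic A p q r ⟧ v
      ≈⟨ +ᴹ-congʳ (+ᴹ-cong (+ᴹ-cong A³v (scaled p A²v)) (scaled q Av≈tv)) ⟩
    (t * (t * t)) *ₗ v +ᴹ (p * (t * t)) *ₗ v +ᴹ (q * t) *ₗ v +ᴹ r *ₗ v
      ≈⟨ +ᴹ-congʳ (+ᴹ-congʳ (*ₗ-distribʳ v _ _)) ⟨
    (t * (t * t) + p * (t * t)) *ₗ v +ᴹ (q * t) *ₗ v +ᴹ r *ₗ v
      ≈⟨ +ᴹ-congʳ (*ₗ-distribʳ v _ _) ⟨
    (t * (t * t) + p * (t * t) + q * t) *ₗ v +ᴹ r *ₗ v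
      ≈⟨ *ₗ-distribʳ v _ _ ⟨
    (t * (t * t) + p * (t * t) + q * t + r) *ₗ v ∎
    where
    scaled : ∀ s {x u} → u ≈ᴹ x *ₗ v → s *ₗ u ≈ᴹ (s * x) *ₗ v
    scaled s u≈xv = ≈ᴹ-trans (*ₗ-congˡ u≈xv) (≈ᴹ-sym (*ₗ-assoc s _ v))

    applied : ∀ {x u} → u ≈ᴹ x *ₗ v → ⟦ A ⟧ u ≈ᴹ (t * x) *ₗ v
    applied {x} {u} u≈xv = begin
      ⟦ A ⟧ u        ≈⟨ End.⟦⟧-cong A u≈xv ⟩
      ⟦ A ⟧ (x *ₗ v) ≈⟨ End.*ₗ-homo A x v ⟩
      x *ₗ ⟦ A ⟧ v   ≈⟨ scaled x Av≈tv ⟩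
      (x * t) *ₗ v   ≈⟨ *ₗ-congʳ (F.*-comm x t) ⟩
      (t * x) *ₗ v   ∎

    A²v : ⟦ A ⟧ (⟦ A ⟧ v) ≈ᴹ (t * t) *ₗ v
    A²v = applied Av≈tv

    A³v : ⟦ A ⟧ (⟦ A ⟧ (⟦ A ⟧ v)) ≈ᴹ (t * (t * t)) *ₗ v
    A³v = applied A²v

  -- Instantiated with the negated eigenvalues, so that no subtraction occurs
  -- and the identity is one of semirings.
  monic-cubic-factorization : ∀ t x y z →
    t * (t * t) + (x + y + z) * (t * t) + (x * y + y * z + z * x) * t + x * y * z
      ≈ (t + x) * ((t + y) * (t + z))
  monic-cubic-factorization = S.solve 4 (λ t x y z →
    t :* (t :* t) :+ (x :+ y :+ z) :* (t :* t)
      :+ (x :* y :+ y :* z :+ z :* x) :* t :+ x :* y :* z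
      := (t :+ x) :* ((t :+ y) :* (t :+ z))) F.refl
    where
    module S = SemiringSolver F.commutativeSemiring
    open S using (_:+_; _:*_; _:=_)

  -- Diagonalizability provides an eigenbasis with eigenvalues of its own. Each of them equals some
  -- `θ j`, hence is a root of the cubic, so the cubic kills the basis and, by linearity, all of V.
  annihilating-cubic : ∀ {A} {E : Fin 3 → End F V} → MultiplicityFree F V A →
    IsPrimitiveIdempotents F V A E →
    ∃[ p ] ∃[ q ] ∃[ r ] ∀ v → ⟦ cubic A p q r ⟧ v ≈ᴹ 0ᴹ
  annihilating-cubic {A} ((n , b , basis , eigen) , _) idempotents =
    p , q , r , vanishes
    where
    open IsPrimitiveIdempotents idempotents

    x y z p q r : F.Carrier
    x = - θ 0F
    y = - θ 1F
    z = - θ 2F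
    -- The elementary symmetric polynomials in the negated eigenvalues.
    p = x + y + z
    q = x * y + y * z + z * x
    r = x * y * z

    opposite : ∀ {t s} → t ≈ s → t + - s ≈ 0#
    opposite {s = s} t≈s = F.trans (F.+-congʳ t≈s) (F.-‿inverseʳ s)

    root : ∀ {t} i → t ≈ θ i → (t + x) * ((t + y) * (t + z)) ≈ 0#
    root 0F t≈θ = F.trans (F.*-congʳ (opposite t≈θ)) (F.zeroˡ _)
    root 1F t≈θ = F.trans
      (F.*-congˡ (F.trans (F.*-congʳ (opposite t≈θ)) (F.zeroˡ _))) (F.zeroʳ _)
    root 2F t≈θ = F.trans
      (F.*-congˡ (F.trans (F.*-congˡ (opposite t≈θ)) (F.zeroʳ _))) (F.zeroʳ _)

    vanishes-on-basis : ∀ i → ⟦ cubic A p q r ⟧ (b i) ≈ᴹ 0ᴹ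
    vanishes-on-basis i =
      let t , Abi≈tbi = eigen i
          -- Exhaustiveness speaks of eigenvalues only, so a nonzero eigenvector for `t` has to be
          -- exhibited.
          j , t≈θj = θ-exhaustive t (b i , basis-nonzero basis i , Abi≈tbi)
      in begin
        ⟦ cubic A p q r ⟧ (b i) ≈⟨ cubic-eigenvector A p q r Abi≈tbi ⟩
        (t * (t * t) + p * (t * t) + q * t + r) *ₗ b i
          ≈⟨ *ₗ-congʳ (F.trans (monic-cubic-factorization t x y z) (root j t≈θj)) ⟩
        0# *ₗ b i ≈⟨ *ₗ-zeroˡ (b i) ⟩
        0ᴹ        ∎

    vanishes : ∀ v → ⟦ cubic A p q r ⟧ v ≈ᴹ 0ᴹ
    vanishes v = let a , v≈ab = IsBasis.spanning basis tt in
      ≈ᴹ-trans (End.⟦⟧-cong (cubic A p q r) v≈ab)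
               (vanishes-on-linearCombination (cubic A p q r) b vanishes-on-basis a)

  -- Only `A` has to satisfy a cubic, while `X` is arbitrary; exchanging the roles of `A` and `A*`
  -- therefore yields both relations.
  tridiagonal-relation : ∀ (A X : End F V) {p q r} →
    (∀ v → ⟦ cubic A p q r ⟧ v ≈ᴹ 0ᴹ) →
    _≈ᴱ_ F V (0ᴱ F V) ([_,_] F V A
      (_-ᴱ_ F V (_-ᴱ_ F V (_+ᴱ_ F V (_-ᴱ_ F V
        (_∙_ F V (_∙_ F V A A) X)
        (_·_ F V (- 1#) (_∙_ F V (_∙_ F V A X) A)))
        (_∙_ F V (_∙_ F V X A) A))
        (_·_ F V (- p) (_+ᴱ_ F V (_∙_ F V A X) (_∙_ F V X A))))
        (_·_ F V (- q) X)))
  tridiagonal-relation A X {p} {q} {r} cubic≈0 v = ≈ᴹ-sym (begin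
    a (T v) +ᴹ (- 1#) *ₗ T (a v) ≈⟨ +ᴹ-congʳ aTv≈Tav ⟩
    T (a v) +ᴹ (- 1#) *ₗ T (a v) ≈⟨ +ᴹ-congʳ (*ₗ-identityˡ (T (a v))) ⟨
    1# *ₗ T (a v) +ᴹ (- 1#) *ₗ T (a v) ≈⟨ *ₗ-distribʳ (T (a v)) 1# (- 1#) ⟨
    (1# + - 1#) *ₗ T (a v) ≈⟨ *ₗ-congʳ (F.-‿inverseʳ 1#) ⟩
    0# *ₗ T (a v) ≈⟨ *ₗ-zeroˡ (T (a v)) ⟩
    0ᴹ ∎)
    where
    a x T T′ : Carrierᴹ → Carrierᴹ
    a = ⟦ A ⟧
    x = ⟦ X ⟧
    -- `T` is what the second entry of the bracket unfolds to, each subtraction being a scaling by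
    -- `- 1#`; `T′` is the same map with the double negations cancelled.
    T w = a (a (x w)) +ᴹ (- 1#) *ₗ ((- 1#) *ₗ a (x (a w))) +ᴹ x (a (a w))
      +ᴹ (- 1#) *ₗ ((- p) *ₗ (a (x w) +ᴹ x (a w))) +ᴹ (- 1#) *ₗ ((- q) *ₗ x w)
    T′ w = a (a (x w)) +ᴹ a (x (a w)) +ᴹ x (a (a w))
      +ᴹ (p *ₗ a (x w) +ᴹ p *ₗ x (a w)) +ᴹ q *ₗ x w

    double-negation : ∀ s w → (- 1#) *ₗ ((- s) *ₗ w) ≈ᴹ s *ₗ w
    double-negation s w = begin
      (- 1#) *ₗ ((- s) *ₗ w) ≈⟨ *ₗ-assoc (- 1#) (- s) w ⟨
      (- 1# * - s) *ₗ w      ≈⟨ *ₗ-congʳ (F.trans (F.-1*x≈-x (- s)) (F.-‿involutive s)) ⟩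
      s *ₗ w                 ∎

    T≈T′ : ∀ w → T w ≈ᴹ T′ w
    T≈T′ w = +ᴹ-cong (+ᴹ-cong
      -- The term with β = -1 is the double negation of the scalar `1#`.
      (+ᴹ-congʳ (+ᴹ-congˡ (≈ᴹ-trans (double-negation 1# _) (*ₗ-identityˡ _))))
      (≈ᴹ-trans (double-negation p _) (*ₗ-distribˡ p _ _)))
      (double-negation q _)

    a-additive : ∀ {u w u′ w′} → a u ≈ᴹ u′ → a w ≈ᴹ w′ → a (u +ᴹ w) ≈ᴹ u′ +ᴹ w′
    a-additive u↦ w↦ = ≈ᴹ-trans (End.+ᴹ-homo A _ _) (+ᴹ-cong u↦ w↦)

    aT′ : ∀ w → a (T′ w) ≈ᴹ
      a (a (a (x w))) +ᴹ a (a (x (a w))) +ᴹ a (x (a (a w)))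
        +ᴹ (p *ₗ a (a (x w)) +ᴹ p *ₗ a (x (a w))) +ᴹ q *ₗ a (x w)
    aT′ w = a-additive (a-additive (a-additive (a-additive ≈ᴹ-refl ≈ᴹ-refl) ≈ᴹ-refl)
      (a-additive (End.*ₗ-homo A p _) (End.*ₗ-homo A p _))) (End.*ₗ-homo A q _)

    cubic-leading : ∀ w →
      a (a (a w)) +ᴹ p *ₗ a (a w) +ᴹ q *ₗ a w ≈ᴹ -ᴹ (r *ₗ w)
    cubic-leading w = inverseˡ-uniqueᴹ _ _ (cubic≈0 w)

    x-cubic-leading : ∀ w →
      x (a (a (a w))) +ᴹ p *ₗ x (a (a w)) +ᴹ q *ₗ x (a w) ≈ᴹ -ᴹ (r *ₗ x w)
    x-cubic-leading w = begin
      x (a (a (a w))) +ᴹ p *ₗ x (a (a w)) +ᴹ q *ₗ x (a w)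
        ≈⟨ +ᴹ-cong (+ᴹ-congˡ (End.*ₗ-homo X p _)) (End.*ₗ-homo X q _) ⟨
      x (a (a (a w))) +ᴹ x (p *ₗ a (a w)) +ᴹ x (q *ₗ a w)
        ≈⟨ +ᴹ-congʳ (End.+ᴹ-homo X _ _) ⟨
      x (a (a (a w)) +ᴹ p *ₗ a (a w)) +ᴹ x (q *ₗ a w)
        ≈⟨ End.+ᴹ-homo X _ _ ⟨
      x (a (a (a w)) +ᴹ p *ₗ a (a w) +ᴹ q *ₗ a w)
        ≈⟨ End.⟦⟧-cong X (cubic-leading w) ⟩
      x (-ᴹ (r *ₗ w)) ≈⟨ End.-ᴹ-homo X _ ⟩
      -ᴹ x (r *ₗ w)   ≈⟨ -ᴹ‿cong (End.*ₗ-homo X r w) ⟩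
      -ᴹ (r *ₗ x w)   ∎

    aTv≈Tav : a (T v) ≈ᴹ T (a v)
    aTv≈Tav = begin
      a (T v)  ≈⟨ End.⟦⟧-cong A (T≈T′ v) ⟩
      a (T′ v) ≈⟨ aT′ v ⟩
      a (a (a (x v))) +ᴹ a (a (x (a v))) +ᴹ a (x (a (a v)))
        +ᴹ (p *ₗ a (a (x v)) +ᴹ p *ₗ a (x (a v))) +ᴹ q *ₗ a (x v)
        -- The terms ending in `x v`, which make up the cubic at `x v` without its constant term,
        -- are collected in front.
        ≈⟨ solve 6 (λ f g h i j k →
             (((f ⊕ g) ⊕ h) ⊕ (i ⊕ j)) ⊕ k ⊜ ((f ⊕ i) ⊕ k) ⊕ ((g ⊕ h) ⊕ j))
             ≈ᴹ-refl _ _ _ _ _ _ ⟩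
      (a (a (a (x v))) +ᴹ p *ₗ a (a (x v)) +ᴹ q *ₗ a (x v)) +ᴹ common
        -- Here the cubic enters: both leading parts equal `-ᴹ (r *ₗ x v)`, since the scalar `r`
        -- commutes with `X`.
        ≈⟨ +ᴹ-congʳ (≈ᴹ-trans (cubic-leading (x v)) (≈ᴹ-sym (x-cubic-leading v))) ⟩
      (x (a (a (a v))) +ᴹ p *ₗ x (a (a v)) +ᴹ q *ₗ x (a v)) +ᴹ common
        ≈⟨ solve 6 (λ f g h i j k →
             ((f ⊕ i) ⊕ k) ⊕ ((g ⊕ h) ⊕ j) ⊜ (((g ⊕ h) ⊕ f) ⊕ (j ⊕ i)) ⊕ k)
             ≈ᴹ-refl _ _ _ _ _ _ ⟩
      T′ (a v) ≈⟨ T≈T′ (a v) ⟨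
      T (a v)  ∎
      where
      -- The mixed terms, with `x` between two applications of `a`, occur in both products and
      -- cancel in the commutator.
      common : Carrierᴹ
      common = a (a (x (a v))) +ᴹ a (x (a (a v))) +ᴹ p *ₗ a (x (a v))

proposition11p8 : ∀ {c ℓ₁ ℓ₂ m ℓm} (F : HeytingField c ℓ₁ ℓ₂) (V : VectorSpace F m ℓm) →
    HasDimension F V 3 →
    (Φ : HessenbergSystem F V 2) → IsTD F V Φ
proposition11p8 F V _ Φ =
  let p  , q  , _ , A-cubic  = annihilating-cubic F V A-multiplicityFree E-idempotents
      p* , q* , _ , A*-cubic = annihilating-cubic F V A*-multiplicityFree E*-idempotents
  -- The order is β, γ, γ*, ϱ, ϱ*; the signs undo the all-plus form of `cubic`.
  in - 1# , - p , - p* , - q , - q*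
     , tridiagonal-relation F V A A* A-cubic
     , tridiagonal-relation F V A* A A*-cubic
  where
  open HeytingField F using (-_; 1#)
  open HessenbergSystem Φ
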